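{- Box-convexity is not preserved by adding non-maximal codewords: the codes $\mathcal{C} = \{1234, 12, 13, \emptyset\}$ and $\mathcal{D} = \{1234, 12, 13, 14, \emptyset\}$ on $\{1,2,3,4\}$ satisfy $\mathcal{C}\subseteq\mathcal{D}\subseteq\Delta(\mathcal{C})$, the code $\mathcal{C}$ is box-convex (in fact it is realizable by closed intervals in $\mathbb{R}^1$), but $\mathcal{D}$ is not box-convex.
   Context: Write $[n]=\{1,\ldots,n\}$. A code is a set $\mathcal{C}\subseteq 2^{[n]}$; subsets of $[n]$ are abbreviated by listing their elements, e.g. $12=\{1,2\}$. For an ordered (indexed) collection $\mathcal{U} = \{U_1, \ldots, U_n\}$ of sets in $\mathbb{R}^d$, its code is $$\operatorname{code}(\mathcal{U}) = \{\sigma\subseteq [n] \mid \text{there exists } p\in \mathbb{R}^d \text{ such that for all } i\in[n],\ p\in U_i \text{ if and only if } i\in\sigma\},$$ and $\mathcal{U}$ is called a realization of $\operatorname{code}(\mathcal{U})$. An axis-parallel box (box for short) in $\mathbb{R}^d$ is either the empty set or a product $[a_1,b_1]\times\cdots\times[a_d,b_d]$ of nonempty closed intervals (degenerate intervals $a_i=b_i$ allowed). A code is box-convex if, for some $d$, it has a realization in $\mathbb{R}^d$ in which every set is a box. For a code $\mathcal{C}\subseteq 2^{[n]}$, $\Delta(\mathcal{C}) = \{\sigma\subseteq [n]\mid \sigma\subseteq c\text{ for some }c\in \mathcal{C}\}$ is the abstract simplicial complex generated by $\mathcal{C}$. -}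

module Defs where

open import Data.Fin.Base using (Fin)
open import Data.Fin.Subset as Subset using (Subset; inside; outside)
open import Data.Nat.Base using (ℕ)
open import Data.Product.Base using (∃-syntax; Σ-syntax; _×_)
open import Data.Rational.Base as ℚ using (ℚ)
open import Data.Sum.Base using (_⊎_)
open import Data.Vec.Base using ([]; _∷_)
open import Data.Vec.Functional using (Vector)
open import Function.Bundles using (_⇔_)
open import Level using (Level; 0ℓ; suc; _⊔_)
open import Relation.Unary using (Pred; _∈_; _∉_; _⊆_; _≐_; _∪_; ｛_｝; Empty; Satisfiable)

private
  variable
    ℓ : Level
    n d : ℕ

-- Real numbers as two-sided Dedekind cuts of ℚ: q ∈ lower means q < x, and
-- q ∈ upper means x < q.
record ℝ : Set₁ where
  field
    lower upper     : Pred ℚ 0ℓ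
    lower-inhabited : Satisfiable lower
    upper-inhabited : Satisfiable upper
    lower-rounded   : ∀ q → q ∈ lower ⇔ (∃[ r ] q ℚ.< r × r ∈ lower)
    upper-rounded   : ∀ r → r ∈ upper ⇔ (∃[ q ] q ℚ.< r × q ∈ upper)
    disjoint        : ∀ q → q ∈ lower → q ∉ upper
    located         : ∀ q r → q ℚ.< r → q ∈ lower ⊎ r ∈ upper

open ℝ public

infix 4 _≤_

_≤_ : ℝ → ℝ → Set
x ≤ y = lower x ⊆ lower y

Point : ℕ → Set₁
Point d = Vector ℝ d

Collection : ℕ → ℕ → Set₁
Collection n d = Vector (Pred (Point d) 0ℓ) n

-- The element i of [n] = {1,…,n} is represented by the element i - 1 of Fin n.
-- The level is left free because the code of a collection quantifies over
-- points, which form a large type.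
Code : ℕ → (ℓ : Level) → Set (suc ℓ)
Code n ℓ = Pred (Subset n) ℓ

code : Collection n d → Code n (suc 0ℓ)
code U σ = ∃[ p ] (∀ i → p ∈ U i ⇔ i Subset.∈ σ)

infix 4 _Realizes_

_Realizes_ : Collection n d → Code n ℓ → Set (suc 0ℓ ⊔ ℓ)
U Realizes C = code U ≐ C

∏[_,_] : Point d → Point d → Pred (Point d) 0ℓ
∏[ a , b ] p = ∀ i → a i ≤ p i × p i ≤ b i

IsIntervalProduct : Pred (Point d) 0ℓ → Set₁
IsIntervalProduct {d} B =
  Σ[ a ∈ Point d ] Σ[ b ∈ Point d ] (∀ i → a i ≤ b i) × B ≐ ∏[ a , b ]

IsBox : Pred (Point d) 0ℓ → Set₁
IsBox B = Empty B ⊎ IsIntervalProduct B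

BoxConvex : Code n ℓ → Set (suc 0ℓ ⊔ ℓ)
BoxConvex {n} C =
  ∃[ d ] Σ[ U ∈ Collection n d ] (∀ i → IsBox (U i)) × U Realizes C

-- In dimension 1 an interval product is a nonempty closed interval.
IntervalRealizable : Code n ℓ → Set (suc 0ℓ ⊔ ℓ)
IntervalRealizable {n} C =
  Σ[ U ∈ Collection n 1 ] (∀ i → IsIntervalProduct (U i)) × U Realizes C

Δ : Code n ℓ → Code n ℓ
Δ C σ = ∃[ c ] c ∈ C × σ Subset.⊆ c

⟨1234⟩ ⟨12⟩ ⟨13⟩ ⟨14⟩ : Subset 4
⟨1234⟩ = inside ∷ inside  ∷ inside  ∷ inside  ∷ []
⟨12⟩   = inside ∷ inside  ∷ outside ∷ outside ∷ []
⟨13⟩   = inside ∷ outside ∷ inside  ∷ outside ∷ []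
⟨14⟩   = inside ∷ outside ∷ outside ∷ inside  ∷ []

𝓒 𝓓 : Code 4 0ℓ
𝓒 = ｛ ⟨1234⟩ ｝ ∪ ｛ ⟨12⟩ ｝ ∪ ｛ ⟨13⟩ ｝ ∪ ｛ Subset.⊥ ｝
𝓓 = ｛ ⟨1234⟩ ｝ ∪ ｛ ⟨12⟩ ｝ ∪ ｛ ⟨13⟩ ｝ ∪ ｛ ⟨14⟩ ｝ ∪ ｛ Subset.⊥ ｝

-- Every codeword of D outside C lies in Δ C, hence is a non-maximal face.
PreservedByAddingNonMaximalCodewords : (∀ {n} → Code n 0ℓ → Set₁) → Set₁
PreservedByAddingNonMaximalCodewords P =
  ∀ {n} (C D : Code n 0ℓ) → C ⊆ D → D ⊆ Δ C → P C → P D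

{-# OPTIONS --safe #-}
-- In a realization of 𝓓 by boxes, the box U₁ is covered by three petals
-- U₂, U₃, U₄, any two of which meet within U₁ only in the common core.  Take t in
-- the core and, for each petal k, a point pₖ of U₁ in that petal alone.  Some
-- coordinate of pₖ leaves the intervals of the other two petals: otherwise
-- replacing a coordinate of t by that of pₖ gives a point of exactly two petals.
-- If pₖ and pₗ leave at different coordinates, replacing both coordinates of t
-- gives a point of U₁ in no petal.  If all three leave at the same coordinate,
-- then two of them, say pₖ and pₗ, lie there on the same side of t, and the
-- nearer one to t lies, by convexity, in the interval of the petal of the other.
module Submission where

open import Defs
open import Data.Bool.Base using (true; false)
open import Data.Empty using (⊥; ⊥-elim)
open import Data.Fin.Base using (Fin; zero; suc)
open import Data.Fin.Patterns using (0F; 1F; 2F; 3F)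
open import Data.Fin.Properties using (_≟_; sequence)
open import Data.Fin.Subset as Subset using (Subset; inside; ⁅_⁆)
open import Data.Fin.Subset.Properties using (∈⊤; x∈⁅x⁆; x∈⁅y⁆⇒x≡y)
open import Data.Integer.Base using (+_)
open import Data.Nat.Base using (ℕ)
open import Data.Product.Base using (_×_; _,_; proj₁; proj₂; ∃-syntax)
open import Data.Rational.Base as ℚ using (ℚ; 0ℚ; 1ℚ)
import Data.Rational.Properties as ℚ
open import Data.Sum.Base using (_⊎_; inj₁; inj₂)
open import Data.Vec.Base using ([]; _∷_; here; there; tabulate)
open import Data.Vec.Functional using (updateAt)
open import Data.Vec.Functional.Properties using (updateAt-updates; updateAt-minimal)
open import Data.Vec.Properties using ([]=⇒lookup; lookup⇒[]=; lookup∘tabulate)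
open import Effect.Monad using (RawMonad)
open import Function.Base using (_∘_; const; case_of_)
open import Function.Bundles using (_⇔_; mk⇔; module Equivalence)
open import Level using (Level; 0ℓ)
open import Relation.Binary.Definitions using (tri<; tri≈; tri>)
open import Relation.Binary.PropositionalEquality
  using (_≡_; _≢_; refl; sym; trans; subst; ≢-sym)
open import Relation.Nullary.Decidable
  using (Dec; yes; no; does; dec-true; map′; from-yes; _×-dec_; ¬¬-excluded-middle)
open import Relation.Nullary.Negation using (¬¬-Monad)
open import Relation.Nullary.Negation.Core using (¬_; contradiction)
open import Relation.Unary using (Pred; _∈_; _∉_; _⊆_; _≐_)

open Equivalence using (to; from)

private
  variable
    ℓ   : Level
    n d : ℕ

-- Real numbers

_∈[_,_] : ℝ → ℝ → ℝ → Set
z ∈[ a , b ] = a ≤ z × z ≤ b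

lower-downward : ∀ (x : ℝ) {q r} → q ℚ.< r → r ∈ lower x → q ∈ lower x
lower-downward x q<r r∈x = from (lower-rounded x _) (_ , q<r , r∈x)

upper-upward : ∀ (x : ℝ) {q r} → q ℚ.< r → q ∈ upper x → r ∈ upper x
upper-upward x q<r q∈x = from (upper-rounded x _) (_ , q<r , q∈x)

lower<upper : ∀ (x : ℝ) {q r} → q ∈ lower x → r ∈ upper x → q ℚ.< r
lower<upper x {q} {r} q∈x r∈x = ℚ.≰⇒> λ r≤q → case ℚ.<-cmp r q of λ where
  (tri< r<q _ _)  → disjoint x q q∈x (upper-upward x r<q r∈x)
  (tri≈ _ refl _) → disjoint x q q∈x r∈x
  (tri> _ _ q<r)  → ℚ.<-irrefl refl (ℚ.<-≤-trans q<r r≤q)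

-- For `q` below `y`, pick `r` with `q < r` and `r` still below `y`. Locatedness of `x` at `q < r`
-- puts `q` below `x`, or else `x` below `r`, which would force `x ≤ y`.
≰⇒≥ : ∀ {x y} → ¬ x ≤ y → y ≤ x
≰⇒≥ {x} {y} x≰y {q} q∈y with to (lower-rounded y q) q∈y
... | r , q<r , r∈y with located x q r q<r
...   | inj₁ q∈x = q∈x
...   | inj₂ r∈x =
  ⊥-elim (x≰y λ s∈x → lower-downward y (lower<upper x s∈x r∈x) r∈y)

¬¬-≤-total : ∀ x y → ¬ ¬ (x ≤ y ⊎ y ≤ x)
¬¬-≤-total x y k = ¬¬-excluded-middle {A = x ≤ y} λ where
  (yes x≤y) → k (inj₁ x≤y)
  (no x≰y)  → k (inj₂ (≰⇒≥ {x} {y} x≰y))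

fromℚ : ℚ → ℝ
fromℚ x = record
  { lower           = ℚ._< x
  ; upper           = x ℚ.<_
  ; lower-inhabited = x ℚ.- 1ℚ , x-1<x
  ; upper-inhabited = x ℚ.+ 1ℚ , x<x+1
  ; lower-rounded   = λ q → mk⇔
      (λ q<x → let r , q<r , r<x = ℚ.<-dense q<x in r , q<r , r<x)
      (λ (r , q<r , r<x) → ℚ.<-trans q<r r<x)
  ; upper-rounded   = λ r → mk⇔
      (λ x<r → let q , x<q , q<r = ℚ.<-dense x<r in q , q<r , x<q)
      (λ (q , q<r , x<q) → ℚ.<-trans x<q q<r)
  ; disjoint        = λ q → ℚ.<-asym
  ; located         = loc
  }
  where
  x-1<x : x ℚ.- 1ℚ ℚ.< x
  x-1<x = subst (x ℚ.- 1ℚ ℚ.<_) (ℚ.+-identityʳ x)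
    (ℚ.+-monoʳ-< x (from-yes (ℚ.- 1ℚ ℚ.<? 0ℚ)))

  x<x+1 : x ℚ.< x ℚ.+ 1ℚ
  x<x+1 = subst (ℚ._< x ℚ.+ 1ℚ) (ℚ.+-identityʳ x)
    (ℚ.+-monoʳ-< x (from-yes (0ℚ ℚ.<? 1ℚ)))

  loc : ∀ q r → q ℚ.< r → q ℚ.< x ⊎ x ℚ.< r
  loc q r q<r with q ℚ.<? x
  ... | yes q<x = inj₁ q<x
  ... | no q≮x  = inj₂ (ℚ.≤-<-trans (ℚ.≮⇒≥ q≮x) q<r)

fromℚ-mono-≤ : ∀ {q r} → q ℚ.≤ r → fromℚ q ≤ fromℚ r
fromℚ-mono-≤ q≤r s<q = ℚ.<-≤-trans s<q q≤r

fromℚ-cancel-≤ : ∀ {q r} → fromℚ q ≤ fromℚ r → q ℚ.≤ r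
fromℚ-cancel-≤ q≤r = ℚ.≮⇒≥ λ r<q → ℚ.<-irrefl refl (q≤r r<q)

fromℚ-≤-total : ∀ {q r} → q ℚ.< r → ∀ x → fromℚ q ≤ x ⊎ x ≤ fromℚ r
fromℚ-≤-total q<r x with located x _ _ q<r
... | inj₁ q∈x = inj₁ λ s<q → lower-downward x s<q q∈x
... | inj₂ r∈x = inj₂ λ s∈x → lower<upper x s∈x r∈x

-- Codes of collections

-- Finiteness of `Fin n` is essential: double negation is an applicative functor, so it commutes
-- with finite products.
¬¬-∀ : {P : Pred (Fin n) 0ℓ} → (∀ i → ¬ ¬ P i) → ¬ ¬ (∀ i → P i)
¬¬-∀ = sequence (RawMonad.rawApplicative ¬¬-Monad)

∈tabulate-does : {P : Pred (Fin n) 0ℓ} (P? : ∀ i → Dec (P i)) →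
  ∀ i → P i ⇔ i Subset.∈ tabulate (does ∘ P?)
∈tabulate-does P? i = mk⇔
  (λ Pi → lookup⇒[]= i _ (trans (lookup∘tabulate _ i) (dec-true (P? i) Pi)))
  (λ i∈ → witness (P? i) (trans (sym (lookup∘tabulate _ i)) ([]=⇒lookup i∈)))
  where
  witness : {A : Set} (a? : Dec A) → does a? ≡ true → A
  witness (yes a) _ = a

∈code : (U : Collection n d) (p : Point d) (p? : ∀ i → Dec (p ∈ U i)) →
  tabulate (does ∘ p?) ∈ code U
∈code U p p? = p , ∈tabulate-does p?

-- Membership of a real point in a set need not be decidable, so its codeword is obtained only up to
-- double negation.
¬¬-codeword : (U : Collection n d) (p : Point d) →
  ¬ ¬ (∃[ σ ] ∀ i → p ∈ U i ⇔ i Subset.∈ σ)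
¬¬-codeword U p k =
  ¬¬-∀ (λ i → ¬¬-excluded-middle) λ p? → k (_ , ∈tabulate-does p?)

-- Boxes equal products only extensionally; this allows them to be replaced by the products
-- themselves.
≐-Realizes : {U V : Collection n d} {C : Code n ℓ} →
  (∀ i → U i ≐ V i) → U Realizes C → V Realizes C
≐-Realizes U≐V (U⊆C , C⊆U) =
  (λ (p , p⇔) → U⊆C (p , λ i →
    mk⇔ (to (p⇔ i) ∘ proj₁ (U≐V i)) (proj₂ (U≐V i) ∘ from (p⇔ i)))) ,
  (λ σ∈C → let p , p⇔ = C⊆U σ∈C in p , λ i →
    mk⇔ (to (p⇔ i) ∘ proj₂ (U≐V i)) (proj₁ (U≐V i) ∘ from (p⇔ i)))

nonempty-box : {B : Pred (Point d) 0ℓ} {p : Point d} →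
  IsBox B → p ∈ B → IsIntervalProduct B
nonempty-box (inj₁ empty) p∈B = contradiction p∈B (empty _)
nonempty-box (inj₂ prod)  _   = prod

-- Changing one coordinate of a point

_[_≔_] : Point d → Fin d → ℝ → Point d
p [ i ≔ z ] = updateAt p i (const z)

≔-updates : ∀ (p : Point d) i z → (p [ i ≔ z ]) i ≡ z
≔-updates p i z = updateAt-updates i p

≔-minimal : ∀ (p : Point d) {i j} z → j ≢ i → (p [ i ≔ z ]) j ≡ p j
≔-minimal p z j≢i = updateAt-minimal _ _ p j≢i

≔-∈∏ : ∀ (a b : Point d) {p i z} →
  p ∈ ∏[ a , b ] → z ∈[ a i , b i ] → p [ i ≔ z ] ∈ ∏[ a , b ]
≔-∈∏ a b {p} {i} {z} p∈ z∈ j with j ≟ i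
... | yes refl = subst (_∈[ a i , b i ]) (sym (≔-updates p i z)) z∈
... | no j≢i   = subst (_∈[ a j , b j ]) (sym (≔-minimal p z j≢i)) (p∈ j)

-- 𝓓 is not box-convex

-- A uniform indexing of 12, 13 and 14: the box numbered `suc k` is the one that singles out
-- `petal k`.
petal : Fin 3 → Subset 4
petal k = inside ∷ ⁅ k ⁆

petal∈𝓓 : ∀ k → petal k ∈ 𝓓
petal∈𝓓 0F = inj₂ (inj₁ refl)
petal∈𝓓 1F = inj₂ (inj₂ (inj₁ refl))
petal∈𝓓 2F = inj₂ (inj₂ (inj₂ (inj₁ refl)))

suc∈petal : ∀ {k m} → suc m Subset.∈ petal k → m ≡ k
suc∈petal (there m∈) = x∈⁅y⁆⇒x≡y _ m∈

-- Among the codewords only 1234 contains two of the elements 2, 3, 4.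
two-petals : ∀ {σ} → σ ∈ 𝓓 → ∀ {k m} → k ≢ m →
  suc k Subset.∈ σ → suc m Subset.∈ σ → ∀ j → j Subset.∈ σ
two-petals (inj₁ refl) _ _ _ j = ∈⊤
two-petals (inj₂ (inj₁ refl)) = λ k≢m k∈ m∈ →
  contradiction (trans (suc∈petal {0F} k∈) (sym (suc∈petal {0F} m∈))) k≢m
two-petals (inj₂ (inj₂ (inj₁ refl))) = λ k≢m k∈ m∈ →
  contradiction (trans (suc∈petal {1F} k∈) (sym (suc∈petal {1F} m∈))) k≢m
two-petals (inj₂ (inj₂ (inj₂ (inj₁ refl)))) = λ k≢m k∈ m∈ →
  contradiction (trans (suc∈petal {2F} k∈) (sym (suc∈petal {2F} m∈))) k≢m
two-petals (inj₂ (inj₂ (inj₂ (inj₂ refl)))) _ (there (there (there (there ()))))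

petal-cover : ∀ {σ} → σ ∈ 𝓓 → 0F Subset.∈ σ → ∃[ k ] suc k Subset.∈ σ
petal-cover (inj₁ refl) _ = 0F , ∈⊤
petal-cover (inj₂ (inj₁ refl)) _ = 0F , there (x∈⁅x⁆ 0F)
petal-cover (inj₂ (inj₂ (inj₁ refl))) _ = 1F , there (x∈⁅x⁆ 1F)
petal-cover (inj₂ (inj₂ (inj₂ (inj₁ refl)))) _ = 2F , there (x∈⁅x⁆ 2F)
petal-cover (inj₂ (inj₂ (inj₂ (inj₂ refl)))) ()

-- Any petal distinct from `k` would serve, since `leaves-all` passes from one other petal to all of
-- them.
other : Fin 3 → Fin 3
other 0F      = 1F
other (suc _) = 0F

other≢ : ∀ k → k ≢ other k
other≢ 0F ()
other≢ (suc _) ()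

module _ {d} (lo hi : Fin 4 → Point d)
  (realizes : (λ k → ∏[ lo k , hi k ]) Realizes 𝓓) where

  private
    U : Collection 4 d
    U k = ∏[ lo k , hi k ]

    ≔-∈U : ∀ k {x i z} → x ∈ U k → z ∈[ lo k i , hi k i ] → x [ i ≔ z ] ∈ U k
    ≔-∈U k = ≔-∈∏ (lo k) (hi k)

    t : Point d
    t = proj₁ (proj₂ realizes (inj₁ refl))

    t∈U : ∀ k → t ∈ U k
    t∈U k = from (proj₂ (proj₂ realizes (inj₁ refl)) k) ∈⊤

    p : Fin 3 → Point d
    p k = proj₁ (proj₂ realizes (petal∈𝓓 k))

    p∈U : ∀ k i → p k ∈ U i ⇔ i Subset.∈ petal k
    p∈U k = proj₂ (proj₂ realizes (petal∈𝓓 k))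

    p∈disk : ∀ k → p k ∈ U 0F
    p∈disk k = from (p∈U k 0F) here

    p∈petal : ∀ k → p k ∈ U (suc k)
    p∈petal k = from (p∈U k (suc k)) (there (x∈⁅x⁆ k))

    Leaves : Fin 3 → Fin d → Set
    Leaves k i = ∀ m → k ≢ m → ¬ p k i ∈[ lo (suc m) i , hi (suc m) i ]

    in-two-petals : ∀ {k m} → k ≢ m → ∀ x → x ∈ U (suc k) → x ∈ U (suc m) →
      ∀ j → ¬ ¬ x ∈ U j
    in-two-petals k≢m x x∈k x∈m j x∉j = ¬¬-codeword U x λ (σ , x⇔) →
      x∉j (from (x⇔ j) (two-petals (proj₁ realizes (x , x⇔)) k≢m
        (to (x⇔ _) x∈k) (to (x⇔ _) x∈m) j))

    in-some-petal : ∀ x → x ∈ U 0F → ¬ (∀ k → x ∉ U (suc k))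
    in-some-petal x x∈U₀ x∉ = ¬¬-codeword U x λ (σ , x⇔) →
      let k , k∈σ = petal-cover (proj₁ realizes (x , x⇔)) (to (x⇔ 0F) x∈U₀)
      in x∉ k (from (x⇔ (suc k)) k∈σ)

    -- If `p k i` lay in the interval of another petal `m`, then `t` with coordinate `i` replaced
    -- would lie in the petals `k` and `m`, hence in every box, hence in petal `l`.
    leaves-all : ∀ {k l i} → ¬ p k i ∈[ lo (suc l) i , hi (suc l) i ] → Leaves k i
    leaves-all {k} {l} {i} pki∉l m k≢m pki∈m =
      in-two-petals k≢m x
        (≔-∈U (suc k) (t∈U (suc k)) (p∈petal k i))
        (≔-∈U (suc m) (t∈U (suc m)) pki∈m) (suc l)
        λ x∈l → pki∉l (subst (_∈[ lo (suc l) i , hi (suc l) i ])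
          (≔-updates t i (p k i)) (x∈l i))
      where
      x : Point d
      x = t [ i ≔ p k i ]

    -- Otherwise every coordinate of `p k` lies, up to double negation, in the interval of petal
    -- `other k`, so `p k` lies in that petal, against its codeword.
    ¬¬-leaves : ∀ k → ¬ ¬ (∃[ i ] Leaves k i)
    ¬¬-leaves k ∄ = ¬¬-∀ (λ i pki∉ → ∄ (i , leaves-all pki∉)) λ pk∈ →
      other≢ k (sym (suc∈petal (to (p∈U k (suc (other k))) pk∈)))

    same-coordinate : ∀ {k l i j} → k ≢ l → Leaves k i → Leaves l j → ¬ i ≢ j
    same-coordinate {k} {l} {i} {j} k≢l k-leaves l-leaves i≢j =
      in-some-petal x (≔-∈U 0F (≔-∈U 0F (t∈U 0F) (p∈disk k i)) (p∈disk l j)) x∉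
      where
      x : Point d
      x = t [ i ≔ p k i ] [ j ≔ p l j ]

      x∉ : ∀ m → x ∉ U (suc m)
      -- Each petal `m` differs from `l` or from `k`; coordinate `j` excludes `x` in the first case
      -- and coordinate `i` in the second.
      x∉ m x∈m with l ≟ m
      ... | no l≢m = l-leaves m l≢m (subst (_∈[ lo (suc m) j , hi (suc m) j ])
        (≔-updates _ j (p l j)) (x∈m j))
      ... | yes refl = k-leaves m k≢l (subst (_∈[ lo (suc m) i , hi (suc m) i ])
        (trans (≔-minimal _ (p l j) i≢j) (≔-updates t i (p k i))) (x∈m i))

    not-both-below : ∀ {k l i} → k ≢ l → Leaves k i → Leaves l i →
      p k i ≤ t i → p l i ≤ t i → ⊥
    not-both-below {k} {l} {i} k≢l k-leaves l-leaves pk≤t pl≤t =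
      ¬¬-≤-total (p k i) (p l i) λ where
        -- Here `p l i` lies between `p k i` and `t i`, both in the interval of petal `k`.
        (inj₁ pk≤pl) → l-leaves k (≢-sym k≢l)
          ( (λ q∈ → pk≤pl (proj₁ (p∈petal k i) q∈))
          , (λ q∈ → proj₂ (t∈U (suc k) i) (pl≤t q∈)))
        (inj₂ pl≤pk) → k-leaves l k≢l
          ( (λ q∈ → pl≤pk (proj₁ (p∈petal l i) q∈))
          , (λ q∈ → proj₂ (t∈U (suc l) i) (pk≤t q∈)))

    not-both-above : ∀ {k l i} → k ≢ l → Leaves k i → Leaves l i →
      t i ≤ p k i → t i ≤ p l i → ⊥
    not-both-above {k} {l} {i} k≢l k-leaves l-leaves t≤pk t≤pl =
      ¬¬-≤-total (p k i) (p l i) λ where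
        (inj₁ pk≤pl) → k-leaves l k≢l
          ( (λ q∈ → t≤pk (proj₁ (t∈U (suc l) i) q∈))
          , (λ q∈ → proj₂ (p∈petal l i) (pk≤pl q∈)))
        (inj₂ pl≤pk) → l-leaves k (≢-sym k≢l)
          ( (λ q∈ → t≤pl (proj₁ (t∈U (suc k) i) q∈))
          , (λ q∈ → proj₂ (p∈petal k i) (pl≤pk q∈)))

    not-all-leave : ∀ {i} → ¬ (∀ k → Leaves k i)
    not-all-leave {i} leaves =
      ¬¬-∀ (λ k → ¬¬-≤-total (p k i) (t i)) λ side →
        pigeonhole (side 0F) (side 1F) (side 2F)
      where
      Side : Fin 3 → Set
      Side k = p k i ≤ t i ⊎ t i ≤ p k i

      below : ∀ {k l} → k ≢ l → p k i ≤ t i → p l i ≤ t i → ⊥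
      below k≢l = not-both-below k≢l (leaves _) (leaves _)

      above : ∀ {k l} → k ≢ l → t i ≤ p k i → t i ≤ p l i → ⊥
      above k≢l = not-both-above k≢l (leaves _) (leaves _)

      pigeonhole : Side 0F → Side 1F → Side 2F → ⊥
      pigeonhole (inj₁ b₀) (inj₁ b₁) _         = below {0F} {1F} (λ ()) b₀ b₁
      pigeonhole (inj₁ b₀) (inj₂ _)  (inj₁ b₂) = below {0F} {2F} (λ ()) b₀ b₂
      pigeonhole (inj₁ _)  (inj₂ a₁) (inj₂ a₂) = above {1F} {2F} (λ ()) a₁ a₂
      pigeonhole (inj₂ _)  (inj₁ b₁) (inj₁ b₂) = below {1F} {2F} (λ ()) b₁ b₂
      pigeonhole (inj₂ a₀) (inj₁ _)  (inj₂ a₂) = above {0F} {2F} (λ ()) a₀ a₂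
      pigeonhole (inj₂ a₀) (inj₂ a₁) _         = above {0F} {1F} (λ ()) a₀ a₁

  no-box-realization : ⊥
  no-box-realization = ¬¬-∀ ¬¬-leaves λ leaves →
    let i = proj₁ ∘ leaves in
    -- Each chosen coordinate is compared with that of petal `0F`; `same-coordinate` excludes a
    -- difference, so one coordinate serves all three petals.
    not-all-leave λ k → case i k ≟ i 0F of λ where
      (yes ik≡i0) → subst (Leaves k) ik≡i0 (proj₂ (leaves k))
      (no ik≢i0)  → contradiction ik≢i0 (same-coordinate
        (λ { refl → ik≢i0 refl }) (proj₂ (leaves k)) (proj₂ (leaves 0F)))

𝓓-not-box-convex : ¬ BoxConvex 𝓓
𝓓-not-box-convex (d , U , isBox , realizes) =
  no-box-realization (proj₁ ∘ prod) (proj₁ ∘ proj₂ ∘ prod)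
    (≐-Realizes (λ i → proj₂ (proj₂ (proj₂ (prod i)))) realizes)
  where
  prod : ∀ i → IsIntervalProduct (U i)
  -- The codeword 1234 supplies a point common to all four boxes, so none is empty.
  prod i = let p , p⇔ = proj₂ realizes (inj₁ refl) in
    nonempty-box (isBox i) (from (p⇔ i) ∈⊤)

-- 𝓒 is realized by the intervals [0,3], [0,2], [1,3], [1,2]

-- The hypotheses are the traces on `σ` of U₁ = U₂ ∪ U₃ and U₄ = U₂ ∩ U₃. They determine `σ` from
-- whether it contains 2 and 3, which leaves four possibilities.
𝓒-criterion : ∀ σ →
  (1F Subset.∈ σ → 0F Subset.∈ σ) → (2F Subset.∈ σ → 0F Subset.∈ σ) →
  (0F Subset.∈ σ → 1F Subset.∈ σ ⊎ 2F Subset.∈ σ) →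
  (3F Subset.∈ σ → 1F Subset.∈ σ × 2F Subset.∈ σ) →
  (1F Subset.∈ σ → 2F Subset.∈ σ → 3F Subset.∈ σ) → σ ∈ 𝓒
𝓒-criterion (true ∷ true ∷ true ∷ true ∷ []) _ _ _ _ _ = inj₁ refl
𝓒-criterion (true ∷ true ∷ false ∷ false ∷ []) _ _ _ _ _ = inj₂ (inj₁ refl)
𝓒-criterion (true ∷ false ∷ true ∷ false ∷ []) _ _ _ _ _ = inj₂ (inj₂ (inj₁ refl))
𝓒-criterion (false ∷ false ∷ false ∷ false ∷ []) _ _ _ _ _ = inj₂ (inj₂ (inj₂ refl))
𝓒-criterion (_ ∷ true ∷ true ∷ false ∷ []) _ _ _ _ h
  with there (there (there ())) ← h (there here) (there (there here))
𝓒-criterion (_ ∷ _ ∷ false ∷ true ∷ []) _ _ _ h _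
  with there (there ()) ← proj₂ (h (there (there (there here))))
𝓒-criterion (_ ∷ false ∷ _ ∷ true ∷ []) _ _ _ h _
  with there () ← proj₁ (h (there (there (there here))))
𝓒-criterion (true ∷ false ∷ false ∷ _ ∷ []) _ _ h _ _ with h here
... | inj₁ (there ())
... | inj₂ (there (there ()))
𝓒-criterion (false ∷ true ∷ _ ∷ _ ∷ []) h _ _ _ _ with () ← h (there here)
𝓒-criterion (false ∷ _ ∷ true ∷ _ ∷ []) _ h _ _ _ with () ← h (there (there here))

left right : Fin 4 → ℚ
left 0F = 0ℚ
left 1F = 0ℚ
left 2F = 1ℚ
left 3F = 1ℚ

right 0F = + 3 ℚ./ 1
right 1F = + 2 ℚ./ 1
right 2F = + 3 ℚ./ 1
right 3F = + 2 ℚ./ 1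

intervals : Collection 4 1
intervals k = ∏[ const (fromℚ (left k)) , const (fromℚ (right k)) ]

rational∈? : ∀ q k → Dec (const (fromℚ q) ∈ intervals k)
rational∈? q k = map′
  (λ (l≤q , q≤r) _ → fromℚ-mono-≤ l≤q , fromℚ-mono-≤ q≤r)
  (λ q∈ → fromℚ-cancel-≤ (proj₁ (q∈ 0F)) , fromℚ-cancel-≤ (proj₂ (q∈ 0F)))
  ((left k ℚ.≤? q) ×-dec (q ℚ.≤? right k))

intervals-realize : intervals Realizes 𝓒
intervals-realize = code⊆𝓒 , 𝓒⊆code
  where
  code⊆𝓒 : code intervals ⊆ 𝓒
  code⊆𝓒 {σ} (x , x⇔) = 𝓒-criterion σ
    (λ ∈₁ → to (x⇔ 0F) λ { 0F → lower-end ∈₁ , (λ q∈ → 2≤3 (upper-end ∈₁ q∈)) })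
    (λ ∈₂ → to (x⇔ 0F) λ { 0F → (λ q∈ → lower-end ∈₂ (0≤1 q∈)) , upper-end ∈₂ })
    -- The intervals [0,2] and [1,3] overlap, so locatedness at 1 < 2 decides on one that contains
    -- the point, without excluded middle.
    (λ ∈₀ → case fromℚ-≤-total 1<2 (x 0F) of λ where
      (inj₁ 1≤x) → inj₂ (to (x⇔ 2F) λ { 0F → 1≤x , upper-end ∈₀ })
      (inj₂ x≤2) → inj₁ (to (x⇔ 1F) λ { 0F → lower-end ∈₀ , x≤2 }))
    (λ ∈₃ →
      to (x⇔ 1F) (λ { 0F → (λ q∈ → lower-end ∈₃ (0≤1 q∈)) , upper-end ∈₃ }) ,
      to (x⇔ 2F) (λ { 0F → lower-end ∈₃ , (λ q∈ → 2≤3 (upper-end ∈₃ q∈)) }))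
    (λ ∈₁ ∈₂ → to (x⇔ 3F) λ { 0F → lower-end ∈₂ , upper-end ∈₁ })
    where
    lower-end : ∀ {k} → k Subset.∈ σ → fromℚ (left k) ≤ x 0F
    lower-end k∈σ = proj₁ (from (x⇔ _) k∈σ 0F)

    upper-end : ∀ {k} → k Subset.∈ σ → x 0F ≤ fromℚ (right k)
    upper-end k∈σ = proj₂ (from (x⇔ _) k∈σ 0F)

    1<2 : 1ℚ ℚ.< right 1F
    1<2 = from-yes (1ℚ ℚ.<? right 1F)

    0≤1 : fromℚ 0ℚ ≤ fromℚ 1ℚ
    0≤1 = fromℚ-mono-≤ (from-yes (0ℚ ℚ.≤? 1ℚ))

    2≤3 : fromℚ (right 1F) ≤ fromℚ (right 0F)
    2≤3 = fromℚ-mono-≤ (from-yes (right 1F ℚ.≤? right 0F))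

  codeword-at : ∀ q → tabulate (does ∘ rational∈? q) ∈ code intervals
  codeword-at q = ∈code intervals (const (fromℚ q)) (rational∈? q)

  𝓒⊆code : 𝓒 ⊆ code intervals
  -- The rational points 1, 0, 3, 4 have codewords 1234, 12, 13 and the empty set; deciding
  -- membership there evaluates to these subsets.
  𝓒⊆code (inj₁ refl) = codeword-at 1ℚ
  𝓒⊆code (inj₂ (inj₁ refl)) = codeword-at 0ℚ
  𝓒⊆code (inj₂ (inj₂ (inj₁ refl))) = codeword-at (+ 3 ℚ./ 1)
  𝓒⊆code (inj₂ (inj₂ (inj₂ refl))) = codeword-at (+ 4 ℚ./ 1)

𝓒-interval-realizable : IntervalRealizable 𝓒
𝓒-interval-realizable = intervals , isProduct , intervals-realize
  where
  left≤right : ∀ k → left k ℚ.≤ right k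
  left≤right 0F = from-yes (left 0F ℚ.≤? right 0F)
  left≤right 1F = from-yes (left 1F ℚ.≤? right 1F)
  left≤right 2F = from-yes (left 2F ℚ.≤? right 2F)
  left≤right 3F = from-yes (left 3F ℚ.≤? right 3F)

  isProduct : ∀ k → IsIntervalProduct (intervals k)
  isProduct k =
    const (fromℚ (left k)) , const (fromℚ (right k)) ,
    (λ _ → fromℚ-mono-≤ (left≤right k)) , (λ x∈ → x∈) , (λ x∈ → x∈)

interval⇒box-convex : {C : Code n ℓ} → IntervalRealizable C → BoxConvex C
interval⇒box-convex (U , isProduct , realizes) = 1 , U , inj₂ ∘ isProduct , realizes

-- Inclusions between the two codes

𝓒⊆𝓓 : 𝓒 ⊆ 𝓓
𝓒⊆𝓓 (inj₁ refl) = inj₁ refl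
𝓒⊆𝓓 (inj₂ (inj₁ refl)) = inj₂ (inj₁ refl)
𝓒⊆𝓓 (inj₂ (inj₂ (inj₁ refl))) = inj₂ (inj₂ (inj₁ refl))
𝓒⊆𝓓 (inj₂ (inj₂ (inj₂ refl))) = inj₂ (inj₂ (inj₂ (inj₂ refl)))

-- The codeword 1234 is the whole ground set, so `Δ 𝓒` contains every subset.
𝓓⊆Δ𝓒 : 𝓓 ⊆ Δ 𝓒
𝓓⊆Δ𝓒 _ = ⟨1234⟩ , inj₁ refl , λ _ → ∈⊤

mainTheorem5 : ¬ PreservedByAddingNonMaximalCodewords BoxConvex
    × (𝓒 ⊆ 𝓓) × (𝓓 ⊆ Δ 𝓒)
    × BoxConvex 𝓒
    × IntervalRealizable 𝓒
    × ¬ BoxConvex 𝓓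
mainTheorem5 =
  (λ preserved → 𝓓-not-box-convex (preserved 𝓒 𝓓 𝓒⊆𝓓 𝓓⊆Δ𝓒 𝓒-box-convex)) ,
  𝓒⊆𝓓 , 𝓓⊆Δ𝓒 , 𝓒-box-convex , 𝓒-interval-realizable , 𝓓-not-box-convex
  where
  𝓒-box-convex : BoxConvex 𝓒
  𝓒-box-convex = interval⇒box-convex 𝓒-interval-realizable
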